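{- Let $E=(\Phi_{BV},\Phi_{IA},I)$ be a theory-modular encoding (containing no query) and let $\chi_q=\forall\bar y_{q^{BV}}.\ (\phi_q[\bar y_{q^{BV}}]\wedge q^{BV}(\bar y_{q^{BV}}))\to\bot$ be a $\Sigma_{BV}$-query, with $\phi_q\in QF_{BV}$ and $q^{BV}\in\Pi^{BV}$. If the procedure $\mathrm{Solve}$ run on $E$ and $\chi_q$ returns SAT (resp. UNSAT), then $(\Phi_{BV}\cup\{\chi_q\},\Phi_{IA},I)$ is satisfiable (resp. unsatisfiable) modulo $(T_{BV},T_{IA})$.
   Context: **Theories.** $\Sigma_{BV}$ is the many-sorted first-order signature of SMT-LIB fixed-size bit-vectors: a sort $BV_n$ for each $n\ge 1$; predicates: equality, unsigned and signed comparisons; functions: a constant for every bit-vector, and the usual arithmetic, bitwise, shift, extraction and concatenation operators. $\Sigma_{IA}$ is the signature of integer arithmetic: one sort $Int$, predicates $=,<,\le$, a constant for every integer, and $+,-,\cdot,\mathrm{div},\mathrm{mod}$. $T_{BV}$ and $T_{IA}$ are the corresponding SMT-LIB theories, with fixed standard models $M_{BV}$ (the domain of $BV_n$ is the finite set of all bit-vectors of width $n$) and $M_{IA}$ (domain $\mathbb{Z}$). Satisfiability and validity modulo $T_{BV}$ (resp. $T_{IA}$) are understood with respect to $M_{BV}$ (resp. $M_{IA}$). $QF_{BV}$, $QF_{IA}$ are the classes of quantifier-free formulas over $\Sigma_{BV}$, $\Sigma_{IA}$. For a formula $\varphi$ with free variables $\bar x$ and a structure $M$, $[\![\varphi]\!]_M$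 is the set of value tuples for $\bar x$ satisfying $\varphi$ in $M$. $D_{\bar x}$ denotes the product of the domains in $M_{BV}$ of the sorts of the bit-vector variables $\bar x$. **CHCs.** Let $\Pi$ be a set of fresh (uninterpreted) predicate symbols typed over the sorts of a signature $\Sigma$. A CHC over $\Sigma\cup\Pi$ is a sentence $\forall\bar x.\ (\phi[\bar x]\wedge\bigwedge_j p_j(\bar x_{p_j}))\to H$, where $\phi$ is a quantifier-free $\Sigma$-formula (the constraint) in which all variables of $\bar x$ appear, $p_j\in\Pi$ (repetitions allowed), $\bar x_{p_j}\subseteq\bar x$, and the head $H$ is either $h(\bar x_h)$ with $h\in\Pi$, $\bar x_h\subseteq\bar x$ (a rule; a fact if there are no $p_j$), or $\bot$ (a query). The left-hand side is the body. **Single-theory semantics and solutions.** For a set $\Psi$ of CHCs over $\Sigma_a\cup\Pi$ ($a\in\{BV,IA\}$), the semantics of $p\in\Pi$ in $\Psi$ is $\bigcup_n S^n(p)$, where $S^n(p)$ is the union, over all rules $\forall\bar x.\,B\to p(\bar x_p)$ in $\Psi$, of the set of values of $\bar x_p$ under assignments satisfying $B$ in the expansion of $M_a$ interpreting each $q\in\Pi$ as $\emptyset$ if $n=0$ and as $S^{n-1}(q)$ if $n>0$. $\Psi$ is satisfiable modulo $T_a$ if all its queries hold in the expansion of $M_a$ interpreting each $p$ by its semantics. A $\Sigma_a$-interpretation $J$ assigns to each $p\in\Pi$ a quantifier-free $\Sigma_a$-formula $J(p)$ with free variables in a fixed tuple $\bar y_p$ (of the sorts of $p$); $J\models_{T_a}\Psi$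 means that for each CHC in $\Psi$, replacing each application $p(\bar x_p)$ by $J(p)[\bar y_p\mapsto\bar x_p]$ gives a formula valid modulo $T_a$. $\Psi\vdash_{T_a}\bot$ with refutation $\pi$ means that $\Psi$ is unsatisfiable modulo $T_a$ and $\pi$ is a derivation tree of $\bot$ from $\Psi$: its root is $\bot$, and every other node is labeled $\langle r,\psi\rangle$ with $r\in\Pi$ and $\psi$ a quantifier-free $\Sigma_a$-formula over $\bar y_r$ that is satisfiable and such that $[\![\psi]\!]_{M_a}$ is contained in the semantics of $r$ in $\Psi$; leaves are derived from facts of $\Psi$; and if the only query of $\Psi$ has body $\phi\wedge p(\bar y_p)\wedge\cdots$, the root has a single child $\langle p,\psi\rangle$, and it satisfies that $\psi\wedge\phi$ is satisfiable modulo $T_a$. **Transformers.** Let $\Phi$ be a set of CHCs over $\Sigma_{BV}\cup\Pi$. A fixed bijection $x\mapsto x'$ maps bit-vector variables to integer variables. Each bit-vector variable $x$ of sort $BV_n$ has a domain transformer $\delta_x$, an injective map from the set of bit-vectors of width $n$ to $\mathbb{Z}$; it is required that all variables appearing in the same argument position of an uninterpreted predicate $p$ in $\Phi$ (and the corresponding variable of $\bar y_{p^{BV}}$) have the same domain transformer. $\delta_{\bar x}$ acts componentwise on tuples and elementwise on sets; $\delta_p=\delta_{\bar x_p}$ for any application $p(\bar x_p)$; $\delta^{ -1}$ denotes preimage. $\rho(x')$ is the $\Sigma_{IA}$-constraint (domain restriction) expressing that $x'$ lies in the image of $\delta_x$. A theory transformer $\tau_{BV\to IA}$ maps every $\varphi\in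 QF_{BV}$ with free variables $\bar x$ to a $QF_{IA}$ formula with free variables $\bar x'$ such that $[\![\varphi]\!]_{M_{BV}}=\delta_{\bar x}^{ -1}\big([\![\tau_{BV\to IA}(\varphi)]\!]_{M_{IA}}\cap\delta_{\bar x}(D_{\bar x})\big)$. A theory transformer $\tau_{IA\to BV}$ maps every $\varphi'\in QF_{IA}$ with free variables $\bar x'$ to a $QF_{BV}$ formula with free variables $\bar x$ such that $[\![\tau_{IA\to BV}(\varphi')]\!]_{M_{BV}}=\delta_{\bar x}^{ -1}\big([\![\varphi']\!]_{M_{IA}}\cap\delta_{\bar x}(D_{\bar x})\big)$. Both transformers are fixed. **Theory-modular encoding.** Given $\Delta_{BV}\subseteq\Phi$, $\Delta_{IA}=\Phi\setminus\Delta_{BV}$, the encoding of $\Phi$ is $E=(\Phi_{BV},\Phi_{IA},I)$, where, with fresh copies $\Pi^{BV}=\{p^{BV}:p\in\Pi\}$ (same types) and $\Pi^{IA}=\{p^{IA}:p\in\Pi\}$ (all arguments of sort $Int$): - $\Phi_{BV}$ is obtained from $\Delta_{BV}$ by replacing each $p$ by $p^{BV}$. - $\Phi_{IA}$ is obtained from $\Delta_{IA}$ by replacing each CHC $\forall\bar x.\,(\phi\wedge\bigwedge_j p_j(\bar x_{p_j}))\to h(\bar x_h)$ by $\forall\bar x'.\,(\tau_{BV\to IA}(\phi)\wedge\bigwedge_j p_j^{IA}(\bar x'_{p_j})\wedge\bigwedge_{x\in\bar y}\rho(x'))\to h^{IA}(\bar x'_h)$, where $\bar y=\bar x\setminus\bigcup_j\bar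 x_{p_j}$; a head $\bot$ is left unchanged. - $I=I_{BV}\cup I_{IA}$: $I_{BV}$ consists of all pairs $(p^{BV},p^{IA})$ such that $p^{BV}$ is the head predicate of some CHC in $\Phi_{BV}$ and $p^{IA}$ occurs in the body of some CHC in $\Phi_{IA}$; $I_{IA}$ consists of all pairs $(p^{IA},p^{BV})$ such that $p^{IA}$ is the head predicate of some CHC in $\Phi_{IA}$ and $p^{BV}$ occurs in the body of some CHC in $\Phi_{BV}$. **Semantics of the encoding.** (The same definitions apply to $(\Phi_{BV}\cup\{\chi_q\},\Phi_{IA},I)$.) For $\{a,b\}=\{BV,IA\}$, $p^a\in\Pi^a$ and $n\in\mathbb{N}$: $[\![p^a]\!]^n=L^n(p^a)\cup X^n(p^a)$. The local part $L^n(p^a)$ is the union, over all rules $\forall\bar x.\,B\to p^a(\bar x_{p^a})$ in $\Phi_a$, of the set of values of $\bar x_{p^a}$ under assignments satisfying $B$ in the expansion of $M_a$ interpreting every $q^a\in\Pi^a$ as $\emptyset$ if $n=0$ and as $[\![q^a]\!]^{n-1}$ if $n>0$. The external part $X^n(p^a)$ is $\emptyset$ if $n=0$ or $(p^b,p^a)\notin I$; otherwise it is $\delta_p([\![p^{BV}]\!]^{n-1})$ if $a=IA$, and $\delta_p^{ -1}([\![p^{IA}]\!]^{n-1})$ if $a=BV$. Set $[\![p^a]\!]=\bigcup_n[\![p^a]\!]^n$. The triple is satisfiable modulo $(T_{BV},T_{IA})$ if for each $a$, every query of the $a$-fragment is true in the expansion of $M_a$ interpreting each $p^a$ as $[\![p^a]\!]$;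 otherwise it is unsatisfiable. **The procedure Solve.** It is a (nondeterministic) transition system. A state is a triple $(Q,U,O)$ where $Q$ is a finite set of proof obligations $(p^a,\phi)$ ($p^a\in\Pi^a$, $\phi$ a quantifier-free $\Sigma_a$-formula over $\bar y_{p^a}$), and $U$, $O$ are sets of lemmas $(p^a,\psi)$ of the same shape; here $\bar y_{p^{IA}}=\bar y'_{p^{BV}}$. Write $\tau_a$ for the theory transformer from $a$ to the other theory $b$. Let $R_{IA}(\bar y)=\bigwedge_{y'\in\bar y}\rho(y')$ and $R_{BV}(\bar y)=\top$. For $\{a,b\}=\{BV,IA\}$ put - $\Phi_a^{O}=\Phi_a\cup\{\forall\bar y_{s^a}.\,(\bigwedge_{(s^a,\psi)\in O}\psi\wedge R_a(\bar y_{s^a}))\to s^a(\bar y_{s^a}) : (s^b,s^a)\in I\}$, - $\Phi_a^{U}=\Phi_a\cup\{\forall\bar y_{s^a}.\,(\bigvee_{(s^a,\psi)\in U}\psi\wedge R_a(\bar y_{s^a}))\to s^a(\bar y_{s^a}) : (s^b,s^a)\in I\}$ (the disjunction is over lemmas and is conjoined with $R_a$; the empty conjunction is $\top$, the empty disjunction is $\bot$), - $\mathrm{Query}(p^a,\phi)=\{\forall\bar y_{p^a}.\,(\phi\wedge p^a(\bar y_{p^a})\wedge R_a(\bar y_{p^a}))\to\bot\}$. Rules: - Init: the initial state is $(\{(q^{BV},\phi_q)\},\emptyset,\emptyset)$. - NegAnswer: if $(p^a,\phi)\in Q\setminus\{(q^{BV},\phi_q)\}$ and $J\models_{T_a}\Phi_a^{O}\cup\mathrm{Query}(p^a,\phi)$,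 move to $(Q\setminus\{(p^a,\phi)\},\,U,\,O\cup\{(p^b,\tau_a(J(p^a)))\})$. - PosAnswer: if $(p^a,\phi)\in Q\setminus\{(q^{BV},\phi_q)\}$ and $\Phi_a^{U}\cup\mathrm{Query}(p^a,\phi)\vdash_{T_a}\bot$ with refutation $\pi$ whose root has child $\langle p^a,\psi\rangle$, move to $(Q\setminus\{(p^a,\phi)\},\,U\cup\{(p^b,\tau_a(\psi))\},\,O)$. - Query: if $(p^a,\phi)\in Q$, some $J\models_{T_a}\Phi_a^{U}\cup\mathrm{Query}(p^a,\phi)$, and $\Phi_a^{O}\cup\mathrm{Query}(p^a,\phi)\vdash_{T_a}\bot$ with a refutation having a leaf $\langle r^a,\psi\rangle$ with $(r^b,r^a)\in I$, move to $(Q\cup\{(r^b,\tau_a(\psi))\},U,O)$. - Sat: from a state $(\{(q^{BV},\phi_q)\},U,O)$ such that some $J\models_{T_{BV}}\Phi_{BV}^{O}\cup\mathrm{Query}(q^{BV},\phi_q)$, return SAT. - Unsat: from a state $(\{(q^{BV},\phi_q)\},U,O)$ such that $\Phi_{BV}^{U}\cup\mathrm{Query}(q^{BV},\phi_q)\vdash_{T_{BV}}\bot$, return UNSAT. -}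

module Defs where

open import Data.Bool.Base using (Bool; true; false; not; _∧_; _∨_; _xor_; if_then_else_)
open import Data.Empty using (⊥)
open import Data.Integer.Base as ℤ using (ℤ; +_; +0; +[1+_]; -[1+_])
open import Data.List.Base using (List; []; _∷_; [_]; map; foldr; filter; concatMap)
open import Data.List.Membership.Propositional using (_∈_; mapWith∈)
open import Data.List.Membership.Propositional.Properties using (∈-map⁺; ∈-filter⁻)
open import Data.List.Relation.Unary.All as All using (All; []; _∷_)
import Data.List.Relation.Unary.All.Properties as All
open import Data.List.Relation.Unary.AllPairs using ([]; _∷_)
open import Data.List.Relation.Unary.Any using (Any)
open import Data.List.Relation.Unary.Unique.Propositional using (Unique)
import Data.List.Relation.Unary.Unique.Propositional.Properties as Unique
import Data.List.Membership.DecPropositional as DecMembership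
open import Data.Maybe.Base as Maybe using (Maybe; just; nothing)
open import Data.Nat.Base as ℕ using (ℕ; zero; suc)
open import Data.Nat.DivMod using (_/_; _%_)
import Data.Nat.Properties as ℕ
open import Data.Product.Base using (Σ-syntax; ∃-syntax; _×_; _,_; proj₁; proj₂)
import Data.Product.Properties as Product
open import Data.Sum.Base using (_⊎_)
open import Data.Unit.Base using (⊤)
open import Data.Vec.Base as Vec using (Vec; []; _∷_)
open import Function.Base using (_∘_)
open import Function.Bundles using (_⤖_; module Bijection)
open import Function.Definitions using (Injective)
open import Level using (0ℓ)
open import Relation.Binary.Construct.Closure.ReflexiveTransitive using (Star)
open import Relation.Binary.Definitions using (DecidableEquality)
open import Relation.Binary.PropositionalEquality using (_≡_; refl; cong)
open import Relation.Nullary.Decidable using (yes; no; map′; ¬?)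
open import Relation.Nullary.Negation using (¬_)
open import Relation.Unary using (Pred; ∅; ｛_｝; _∪_; _∩_; _∖_; _⊆_; _≐_; _⊢_)

record Signature : Set₁ where
  field
    Sort : Set
    Func : List Sort → Sort → Set
    Rel  : List Sort → Set

record Structure (Sg : Signature) : Set₁ where
  open Signature Sg
  field
    Dom  : Sort → Set
    func : ∀ {ss s} → Func ss s → All Dom ss → Dom s
    rel  : ∀ {ss} → Rel ss → All Dom ss → Set

module Syntax (Sg : Signature) where
  open Signature Sg

  Var : Set
  Var = Sort × ℕ

  record Ctx : Set where
    constructor ctx
    field
      vars     : List Var
      distinct : Unique vars
  open Ctx public

  singleton : Var → Ctx
  singleton x = ctx [ x ] ([] ∷ [])

  VarOf : Ctx → Sort → Set
  VarOf x̄ s = ∃[ n ] (s , n) ∈ vars x̄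

  mutual
    data Term (x̄ : Ctx) (s : Sort) : Set where
      var : VarOf x̄ s → Term x̄ s
      fun : ∀ {ss} → Func ss s → Terms x̄ ss → Term x̄ s

    data Terms (x̄ : Ctx) : List Sort → Set where
      []  : Terms x̄ []
      _∷_ : ∀ {s ss} → Term x̄ s → Terms x̄ ss → Terms x̄ (s ∷ ss)

  infixr 6 _∧′_
  infixr 5 _∨′_
  infixr 4 _⇒′_

  -- `Formula x̄`: quantifier-free formulas whose variables are among x̄.
  data Formula (x̄ : Ctx) : Set where
    ⊤′ ⊥′          : Formula x̄
    rel            : ∀ {ss} → Rel ss → Terms x̄ ss → Formula x̄
    ¬′_            : Formula x̄ → Formula x̄
    _∧′_ _∨′_ _⇒′_ : Formula x̄ → Formula x̄ → Formula x̄

  ⋀ ⋁ : ∀ {x̄} → List (Formula x̄) → Formula x̄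
  ⋀ = foldr _∧′_ ⊤′
  ⋁ = foldr _∨′_ ⊥′

  mutual
    Occursᵗ : ∀ {x̄ s} → Var → Term x̄ s → Set
    Occursᵗ {s = s} x (var (n , _)) = x ≡ (s , n)
    Occursᵗ x (fun _ ts)            = Occursᵗˢ x ts

    Occursᵗˢ : ∀ {x̄ ss} → Var → Terms x̄ ss → Set
    Occursᵗˢ x []       = ⊥
    Occursᵗˢ x (t ∷ ts) = Occursᵗ x t ⊎ Occursᵗˢ x ts

  Occurs : ∀ {x̄} → Var → Formula x̄ → Set
  Occurs x ⊤′         = ⊥
  Occurs x ⊥′         = ⊥
  Occurs x (rel _ ts) = Occursᵗˢ x ts
  Occurs x (¬′ φ)     = Occurs x φ
  Occurs x (φ ∧′ ψ)   = Occurs x φ ⊎ Occurs x ψ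
  Occurs x (φ ∨′ ψ)   = Occurs x φ ⊎ Occurs x ψ
  Occurs x (φ ⇒′ ψ)   = Occurs x φ ⊎ Occurs x ψ

  -- A sort-preserving substitution [ ȳ ↦ z̄ ], where z̄ is a tuple of (not
  -- necessarily distinct) variables of x̄.
  Renaming : Ctx → Ctx → Set
  Renaming ȳ x̄ = All (VarOf x̄ ∘ proj₁) (vars ȳ)

  idᴿ : ∀ x̄ → Renaming x̄ x̄
  idᴿ x̄ = All.tabulate (_ ,_)

  mutual
    renameᵗ : ∀ {ȳ x̄ s} → Renaming ȳ x̄ → Term ȳ s → Term x̄ s
    renameᵗ r (var (_ , i)) = var (All.lookup r i)
    renameᵗ r (fun f ts)    = fun f (renameᵗˢ r ts)

    renameᵗˢ : ∀ {ȳ x̄ ss} → Renaming ȳ x̄ → Terms ȳ ss → Terms x̄ ss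
    renameᵗˢ r []       = []
    renameᵗˢ r (t ∷ ts) = renameᵗ r t ∷ renameᵗˢ r ts

  rename : ∀ {ȳ x̄} → Renaming ȳ x̄ → Formula ȳ → Formula x̄
  rename r ⊤′         = ⊤′
  rename r ⊥′         = ⊥′
  rename r (rel p ts) = rel p (renameᵗˢ r ts)
  rename r (¬′ φ)     = ¬′ rename r φ
  rename r (φ ∧′ ψ)   = rename r φ ∧′ rename r ψ
  rename r (φ ∨′ ψ)   = rename r φ ∨′ rename r ψ
  rename r (φ ⇒′ ψ)   = rename r φ ⇒′ rename r ψ

module Semantics (Sg : Signature) (M : Structure Sg) where
  open Syntax Sg
  open Structure M renaming (rel to relᴹ; func to funcᴹ)

  Env : Ctx → Set
  Env x̄ = All (Dom ∘ proj₁) (vars x̄)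

  mutual
    evalᵗ : ∀ {x̄ s} → Env x̄ → Term x̄ s → Dom s
    evalᵗ e (var (_ , i)) = All.lookup e i
    evalᵗ e (fun f ts)    = funcᴹ f (evalᵗˢ e ts)

    evalᵗˢ : ∀ {x̄ ss} → Env x̄ → Terms x̄ ss → All Dom ss
    evalᵗˢ e []       = []
    evalᵗˢ e (t ∷ ts) = evalᵗ e t ∷ evalᵗˢ e ts

  ⟦_⟧ : ∀ {x̄} → Formula x̄ → Pred (Env x̄) 0ℓ
  ⟦ ⊤′ ⟧       e = ⊤
  ⟦ ⊥′ ⟧       e = ⊥
  ⟦ rel p ts ⟧ e = relᴹ p (evalᵗˢ e ts)
  ⟦ ¬′ φ ⟧     e = ¬ ⟦ φ ⟧ e
  ⟦ φ ∧′ ψ ⟧   e = ⟦ φ ⟧ e × ⟦ ψ ⟧ e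
  ⟦ φ ∨′ ψ ⟧   e = ⟦ φ ⟧ e ⊎ ⟦ ψ ⟧ e
  ⟦ φ ⇒′ ψ ⟧   e = ⟦ φ ⟧ e → ⟦ ψ ⟧ e

  Valid : ∀ {x̄} → Formula x̄ → Set
  Valid φ = ∀ e → ⟦ φ ⟧ e

  SatisfiableFormula : ∀ {x̄} → Formula x̄ → Set
  SatisfiableFormula φ = ∃[ e ] ⟦ φ ⟧ e

  evalᴿ : ∀ ȳ x̄ → Env x̄ → Renaming ȳ x̄ → Env ȳ
  evalᴿ ȳ x̄ e = All.map (All.lookup e ∘ proj₂)

-- BV[1+ n ] is the sort of bit-vectors of width 1 + n.
data BVSort : Set where
  BV[1+_] : ℕ → BVSort

width : BVSort → ℕ
width BV[1+ n ] = suc n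

_≟ˢ_ : DecidableEquality BVSort
BV[1+ m ] ≟ˢ BV[1+ n ] = map′ (cong BV[1+_]) (λ { refl → refl }) (m ℕ.≟ n)

-- Least significant bit first.
BitVec : ℕ → Set
BitVec = Vec Bool

module BitVector where

  toℕ : ∀ {n} → BitVec n → ℕ
  toℕ []       = 0
  toℕ (b ∷ bs) = (if b then 1 else 0) ℕ.+ 2 ℕ.* toℕ bs

  -- k modulo 2 ^ n
  fromℕ : ∀ {n} → ℕ → BitVec n
  fromℕ {zero}  k = []
  fromℕ {suc n} k = (k % 2 ℕ.≡ᵇ 1) ∷ fromℕ (k / 2)

  msb : ∀ {n} → BitVec (suc n) → Bool
  msb = Vec.last

  toℤ : ∀ {n} → BitVec (suc n) → ℤ
  toℤ {n} v = if msb v then + toℕ v ℤ.- + (2 ℕ.^ suc n) else + toℕ v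

  infix 8 _/2^_
  _/2^_ : ℕ → ℕ → ℕ
  k /2^ i = _/_ k (2 ℕ.^ i) {{ℕ.m^n≢0 2 i}}

  not′ : ∀ {n} → BitVec n → BitVec n
  not′ = Vec.map not

  neg : ∀ {n} → BitVec n → BitVec n
  neg {n} s = fromℕ (2 ℕ.^ n ℕ.∸ toℕ s)

  add sub mul udiv urem shl lshr : ∀ {n} → BitVec n → BitVec n → BitVec n
  add s t = fromℕ (toℕ s ℕ.+ toℕ t)
  sub s t = add s (neg t)
  mul s t = fromℕ (toℕ s ℕ.* toℕ t)
  udiv s t with toℕ t
  ... | zero      = Vec.replicate _ true
  ... | k@(suc _) = fromℕ (toℕ s / k)
  urem s t with toℕ t
  ... | zero      = s
  ... | k@(suc _) = fromℕ (toℕ s % k)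
  shl s t  = fromℕ (toℕ s ℕ.* 2 ℕ.^ toℕ t)
  lshr s t = fromℕ (toℕ s /2^ toℕ t)

  sdiv srem smod ashr : ∀ {n} → BitVec (suc n) → BitVec (suc n) → BitVec (suc n)
  sdiv s t with msb s | msb t
  ... | false | false = udiv s t
  ... | true  | false = neg (udiv (neg s) t)
  ... | false | true  = neg (udiv s (neg t))
  ... | true  | true  = udiv (neg s) (neg t)
  srem s t with msb s | msb t
  ... | false | false = urem s t
  ... | true  | false = neg (urem (neg s) t)
  ... | false | true  = urem s (neg t)
  ... | true  | true  = neg (urem (neg s) (neg t))
  smod s t = if toℕ u ℕ.≡ᵇ 0 then u else adjust (msb s) (msb t)
    where
    abs : ∀ {n} → BitVec (suc n) → BitVec (suc n)
    abs v = if msb v then neg v else v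
    u = urem (abs s) (abs t)
    adjust : Bool → Bool → BitVec _
    adjust false false = u
    adjust true  false = add (neg u) t
    adjust false true  = add u t
    adjust true  true  = neg u
  ashr s t = if msb s then not′ (lshr (not′ s) t) else lshr s t

  rotateLeft rotateRight : ∀ {n} → ℕ → BitVec (suc n) → BitVec (suc n)
  rotateLeft  zero    v = v
  rotateLeft  (suc i) v = rotateLeft i (Vec.last v ∷ Vec.init v)
  rotateRight zero    v = v
  rotateRight (suc i) v = rotateRight i (Vec.tail v Vec.∷ʳ Vec.head v)

  comp : ∀ {n} → BitVec n → BitVec n → BitVec 1
  comp s t = (toℕ s ℕ.≡ᵇ toℕ t) ∷ []

data BVFunc : List BVSort → BVSort → Set where
  const : ∀ {s} → BitVec (width s) → BVFunc [] s
  bvnot bvneg : ∀ {s} → BVFunc [ s ] s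
  bvand bvor bvnand bvnor bvxor bvxnor : ∀ {s} → BVFunc (s ∷ s ∷ []) s
  bvadd bvsub bvmul bvudiv bvurem bvsdiv bvsrem bvsmod : ∀ {s} → BVFunc (s ∷ s ∷ []) s
  bvshl bvlshr bvashr : ∀ {s} → BVFunc (s ∷ s ∷ []) s
  bvcomp : ∀ {s} → BVFunc (s ∷ s ∷ []) BV[1+ 0 ]
  concat : ∀ {m n} → BVFunc (BV[1+ m ] ∷ BV[1+ n ] ∷ []) BV[1+ n ℕ.+ suc m ]
  extract : ∀ {n} i j → j ℕ.≤ i → i ℕ.≤ n → BVFunc [ BV[1+ n ] ] BV[1+ i ℕ.∸ j ]
  -- `repeat k` makes 1 + k copies.
  repeat : ∀ {n} k → BVFunc [ BV[1+ n ] ] BV[1+ n ℕ.+ k ℕ.* suc n ]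
  zero-extend sign-extend : ∀ {n} k → BVFunc [ BV[1+ n ] ] BV[1+ n ℕ.+ k ]
  rotate-left rotate-right : ∀ {s} → ℕ → BVFunc [ s ] s

data BVRel : List BVSort → Set where
  eq : ∀ {s} → BVRel (s ∷ s ∷ [])
  bvult bvule bvugt bvuge bvslt bvsle bvsgt bvsge : ∀ {s} → BVRel (s ∷ s ∷ [])

Σ-BV : Signature
Σ-BV = record { Sort = BVSort ; Func = BVFunc ; Rel = BVRel }

module _ where
  open BitVector

  bvFunc : ∀ {ss s} → BVFunc ss s → All (BitVec ∘ width) ss → BitVec (width s)
  bvFunc (const c)         []           = c
  bvFunc bvnot             (s ∷ [])     = not′ s
  bvFunc bvneg             (s ∷ [])     = neg s
  bvFunc bvand             (s ∷ t ∷ []) = Vec.zipWith _∧_ s t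
  bvFunc bvor              (s ∷ t ∷ []) = Vec.zipWith _∨_ s t
  bvFunc bvnand            (s ∷ t ∷ []) = not′ (Vec.zipWith _∧_ s t)
  bvFunc bvnor             (s ∷ t ∷ []) = not′ (Vec.zipWith _∨_ s t)
  bvFunc bvxor             (s ∷ t ∷ []) = Vec.zipWith _xor_ s t
  bvFunc bvxnor            (s ∷ t ∷ []) = not′ (Vec.zipWith _xor_ s t)
  bvFunc bvadd             (s ∷ t ∷ []) = add s t
  bvFunc bvsub             (s ∷ t ∷ []) = sub s t
  bvFunc bvmul             (s ∷ t ∷ []) = mul s t
  bvFunc bvudiv            (s ∷ t ∷ []) = udiv s t
  bvFunc bvurem            (s ∷ t ∷ []) = urem s t
  bvFunc (bvsdiv {BV[1+ _ ]}) (s ∷ t ∷ []) = sdiv s t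
  bvFunc (bvsrem {BV[1+ _ ]}) (s ∷ t ∷ []) = srem s t
  bvFunc (bvsmod {BV[1+ _ ]}) (s ∷ t ∷ []) = smod s t
  bvFunc bvshl             (s ∷ t ∷ []) = shl s t
  bvFunc bvlshr            (s ∷ t ∷ []) = lshr s t
  bvFunc (bvashr {BV[1+ _ ]}) (s ∷ t ∷ []) = ashr s t
  bvFunc bvcomp            (s ∷ t ∷ []) = comp s t
  -- The first operand of `concat` holds the most significant bits.
  bvFunc concat            (s ∷ t ∷ []) = t Vec.++ s
  bvFunc (extract i j _ _) (s ∷ [])     = fromℕ (toℕ s /2^ j)
  bvFunc (repeat k)        (s ∷ [])     = Vec.concat (Vec.replicate (suc k) s)
  bvFunc (zero-extend k)   (s ∷ [])     = s Vec.++ Vec.replicate k false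
  bvFunc (sign-extend k)   (s ∷ [])     = s Vec.++ Vec.replicate k (msb s)
  bvFunc (rotate-left {BV[1+ _ ]} i)  (s ∷ []) = rotateLeft i s
  bvFunc (rotate-right {BV[1+ _ ]} i) (s ∷ []) = rotateRight i s

  bvRel : ∀ {ss} → BVRel ss → All (BitVec ∘ width) ss → Set
  bvRel eq    (s ∷ t ∷ []) = s ≡ t
  bvRel bvult (s ∷ t ∷ []) = toℕ s ℕ.< toℕ t
  bvRel bvule (s ∷ t ∷ []) = toℕ s ℕ.≤ toℕ t
  bvRel bvugt (s ∷ t ∷ []) = toℕ s ℕ.> toℕ t
  bvRel bvuge (s ∷ t ∷ []) = toℕ s ℕ.≥ toℕ t
  bvRel (bvslt {BV[1+ _ ]}) (s ∷ t ∷ []) = toℤ s ℤ.< toℤ t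
  bvRel (bvsle {BV[1+ _ ]}) (s ∷ t ∷ []) = toℤ s ℤ.≤ toℤ t
  bvRel (bvsgt {BV[1+ _ ]}) (s ∷ t ∷ []) = toℤ s ℤ.> toℤ t
  bvRel (bvsge {BV[1+ _ ]}) (s ∷ t ∷ []) = toℤ s ℤ.≥ toℤ t

M-BV : Structure Σ-BV
M-BV = record { Dom = BitVec ∘ width ; func = bvFunc ; rel = bvRel }

record IASort : Set where
  constructor Int

data IAFunc : List IASort → IASort → Set where
  const           : ℤ → IAFunc [] Int
  neg             : IAFunc [ Int ] Int
  add sub mul     : IAFunc (Int ∷ Int ∷ []) Int
  div mod         : IAFunc (Int ∷ Int ∷ []) Int

data IARel : List IASort → Set where
  eq lt le : IARel (Int ∷ Int ∷ [])

Σ-IA : Signature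
Σ-IA = record { Sort = IASort ; Func = IAFunc ; Rel = IARel }

-- SMT-LIB does not specify `div` and `mod` by zero; a standard model fixes
-- them by two arbitrary functions.
record DivisionByZero : Set where
  field
    div0 mod0 : ℤ → ℤ

module _ (D : DivisionByZero) where
  open DivisionByZero D

  -- The library's integer division is Euclidean, as is SMT-LIB's.
  divℤ modℤ : ℤ → ℤ → ℤ
  divℤ i +0           = div0 i
  divℤ i j@(+[1+ _ ]) = i ℤ./ j
  divℤ i j@(-[1+ _ ]) = i ℤ./ j
  modℤ i +0           = mod0 i
  modℤ i j@(+[1+ _ ]) = + (i ℤ.% j)
  modℤ i j@(-[1+ _ ]) = + (i ℤ.% j)

  iaFunc : ∀ {ss s} → IAFunc ss s → All (λ _ → ℤ) ss → ℤ
  iaFunc (const c) []           = c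
  iaFunc neg       (i ∷ [])     = ℤ.- i
  iaFunc add       (i ∷ j ∷ []) = i ℤ.+ j
  iaFunc sub       (i ∷ j ∷ []) = i ℤ.- j
  iaFunc mul       (i ∷ j ∷ []) = i ℤ.* j
  iaFunc div       (i ∷ j ∷ []) = divℤ i j
  iaFunc mod       (i ∷ j ∷ []) = modℤ i j

  iaRel : ∀ {ss} → IARel ss → All (λ _ → ℤ) ss → Set
  iaRel eq (i ∷ j ∷ []) = i ≡ j
  iaRel lt (i ∷ j ∷ []) = i ℤ.< j
  iaRel le (i ∷ j ∷ []) = i ℤ.≤ j

  M-IA : Structure Σ-IA
  M-IA = record { Dom = λ _ → ℤ ; func = iaFunc ; rel = iaRel }

-- A predicate symbol p is typed by the sorts of its fixed variable tuple
-- ȳ_p = params p; its argument tuples are the value tuples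
-- for params p.
module Horn (Sg : Signature) (M : Structure Sg)
            {Π : Set} (params : Π → Syntax.Ctx Sg) where
  open Syntax Sg
  open Semantics Sg M

  -- An application p(x̄_p) with x̄_p ⊆ x̄; its arguments are at the same time
  -- the substitution [ ȳ_p ↦ x̄_p ].
  record Atom (x̄ : Ctx) : Set where
    constructor _⟪_⟫
    field
      symbol : Π
      args   : Renaming (params symbol) x̄

  generic : ∀ p → Atom (params p)
  generic p = p ⟪ idᴿ (params p) ⟫

  -- ∀ vars. (constraint ∧ ⋀ body) → head, where head = nothing stands for ⊥.
  -- That every variable appears in the constraint is a separate predicate,
  -- since clauses such as ∀ȳ. ⊤ → s(ȳ) arise in the procedure.
  record Clause : Set where
    field
      vars       : Ctx
      constraint : Formula vars
      body       : List (Atom vars)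
      head       : Maybe (Atom vars)
  open Clause public

  AllVarsAppear : Clause → Set
  AllVarsAppear c = ∀ x → x ∈ Ctx.vars (vars c) → Occurs x (constraint c)

  IsQuery : Clause → Set
  IsQuery c = head c ≡ nothing

  IsFact : Clause → Set
  IsFact c = body c ≡ [] × ¬ IsQuery c

  HeadOf : Pred Clause 0ℓ → Pred Π 0ℓ
  HeadOf Ψ p = ∃[ c ] Ψ c × ∃[ x̄ₚ ] head c ≡ just (p ⟪ x̄ₚ ⟫)

  BodyOf : Pred Clause 0ℓ → Pred Π 0ℓ
  BodyOf Ψ p = ∃[ c ] Ψ c × ∃[ x̄ₚ ] (p ⟪ x̄ₚ ⟫) ∈ body c

  Interpretation : Set₁
  Interpretation = ∀ p → Pred (Env (params p)) 0ℓ

  ⟦_⟧ᴬ : ∀ {x̄} → Atom x̄ → Interpretation → Pred (Env x̄) 0ℓ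
  ⟦_⟧ᴬ {x̄} (p ⟪ x̄ₚ ⟫) 𝓘 e = 𝓘 p (evalᴿ (params p) x̄ e x̄ₚ)

  Body : Interpretation → (c : Clause) → Pred (Env (vars c)) 0ℓ
  Body 𝓘 c e = ⟦ constraint c ⟧ e × All (λ A → ⟦ A ⟧ᴬ 𝓘 e) (body c)

  Produces : Interpretation → Clause → Interpretation
  Produces 𝓘 c p v =
    ∃[ e ] Body 𝓘 c e × ∃[ x̄ₚ ] head c ≡ just (p ⟪ x̄ₚ ⟫)
                                × v ≡ evalᴿ (params p) (vars c) e x̄ₚ

  Consequences : Pred Clause 0ℓ → Interpretation → Interpretation
  Consequences Ψ 𝓘 p v = ∃[ c ] Ψ c × Produces 𝓘 c p v

  S : Pred Clause 0ℓ → ℕ → Interpretation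
  S Ψ zero    = Consequences Ψ (λ _ → ∅)
  S Ψ (suc n) = Consequences Ψ (S Ψ n)

  ClauseSemantics : Pred Clause 0ℓ → Interpretation
  ClauseSemantics Ψ p v = ∃[ n ] S Ψ n p v

  QueriesHold : Pred Clause 0ℓ → Interpretation → Set
  QueriesHold Ψ 𝓘 = ∀ c → Ψ c → IsQuery c → ∀ e → ¬ Body 𝓘 c e

  Satisfiable : Pred Clause 0ℓ → Set
  Satisfiable Ψ = QueriesHold Ψ (ClauseSemantics Ψ)

  SymbolicInterpretation : Set
  SymbolicInterpretation = ∀ p → Formula (params p)

  instantiate : SymbolicInterpretation → (c : Clause) → Formula (vars c)
  instantiate J c =
    constraint c ∧′ ⋀ (map inst (body c)) ⇒′ Maybe.maybe inst ⊥′ (head c)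
    where
    inst : Atom (vars c) → Formula (vars c)
    inst (p ⟪ x̄ₚ ⟫) = rename x̄ₚ (J p)

  infix 4 _⊨_
  _⊨_ : SymbolicInterpretation → Pred Clause 0ℓ → Set
  J ⊨ Ψ = ∀ c → Ψ c → Valid (instantiate J c)

  data Tree : Set where
    node : (r : Π) (ψ : Formula (params r)) → List Tree → Tree

  data Leaf (r : Π) (ψ : Formula (params r)) : Tree → Set where
    here  : Leaf r ψ (node r ψ [])
    below : ∀ {s χ ts} → Any (Leaf r ψ) ts → Leaf r ψ (node s χ ts)

  LabelOK : Pred Clause 0ℓ → (r : Π) → Formula (params r) → Set
  LabelOK Ψ r ψ = SatisfiableFormula ψ × ⟦ ψ ⟧ ⊆ ClauseSemantics Ψ r

  FromFacts : Pred Clause 0ℓ → (r : Π) → Formula (params r) → Set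
  FromFacts Ψ r ψ = ⟦ ψ ⟧ ⊆ Consequences (Ψ ∩ IsFact) (λ _ → ∅) r

  -- Inner nodes are constrained by their labels only.
  data IsDerivation (Ψ : Pred Clause 0ℓ) : Tree → Set where
    leaf  : ∀ {r ψ} → LabelOK Ψ r ψ → FromFacts Ψ r ψ →
            IsDerivation Ψ (node r ψ [])
    inner : ∀ {r ψ t ts} → LabelOK Ψ r ψ → All (IsDerivation Ψ) (t ∷ ts) →
            IsDerivation Ψ (node r ψ (t ∷ ts))

  -- Refutations of a set Ψ whose only query has body φ ∧ p(ȳ_p) ∧ ⋯.  The
  -- root ⊥ is left implicit; its only child is ⟨ p , ψ ⟩.
  record Refutation (Ψ : Pred Clause 0ℓ) (p : Π) (φ : Formula (params p)) : Set where
    field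
      unsatisfiable : ¬ Satisfiable Ψ
      ψ             : Formula (params p)
      subtrees      : List Tree
    child : Tree
    child = node p ψ subtrees
    field
      derivation    : IsDerivation Ψ child
      ψ∧φ-sat       : SatisfiableFormula (ψ ∧′ φ)

data Theory : Set where
  BV IA : Theory

other : Theory → Theory
other BV = IA
other IA = BV

sig : Theory → Signature
sig BV = Σ-BV
sig IA = Σ-IA

module SynBV = Syntax Σ-BV
module SynIA = Syntax Σ-IA

_≟ᵛ_ : DecidableEquality SynBV.Var
_≟ᵛ_ = Product.≡-dec _≟ˢ_ ℕ._≟_

Image : {A B : Set} → (A → B) → Pred B 0ℓ
Image f w = ∃[ v ] f v ≡ w

record DomainTransformers : Set where
  field
    divisionByZero : DivisionByZero
    prime          : SynBV.Var ⤖ SynIA.Var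
    δ              : (x : SynBV.Var) → BitVec (width (proj₁ x)) → ℤ
    δ-injective    : ∀ x → Injective _≡_ _≡_ (δ x)

  model : (a : Theory) → Structure (sig a)
  model BV = M-BV
  model IA = M-IA divisionByZero

  module SemBV = Semantics Σ-BV M-BV
  module SemIA = Semantics Σ-IA (model IA)

  infix 9 _′ _′ᶜ

  _′ : SynBV.Var → SynIA.Var
  _′ = Bijection.to prime

  _′ᶜ : SynBV.Ctx → SynIA.Ctx
  x̄ ′ᶜ = SynIA.ctx (map _′ (SynBV.vars x̄))
                   (Unique.map⁺ (Bijection.injective prime) (SynBV.distinct x̄))

  δ̄ : ∀ x̄ → SemBV.Env x̄ → SemIA.Env (x̄ ′ᶜ)
  δ̄ x̄ e = All.map⁺ (All.map (λ {x} → δ x) e)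

record Transformers : Set where
  field
    domainTransformers : DomainTransformers

  open DomainTransformers domainTransformers public

  field
    ρ      : (x : SynBV.Var) → SynIA.Formula (SynIA.singleton (x ′))
    ρ-spec : ∀ x → SemIA.⟦ ρ x ⟧ ≐ λ e → Image (δ x) (All.head e)

    τ-BV→IA      : ∀ x̄ → SynBV.Formula x̄ → SynIA.Formula (x̄ ′ᶜ)
    τ-BV→IA-spec : ∀ x̄ φ →
      SemBV.⟦ φ ⟧ ≐ δ̄ x̄ ⊢ (SemIA.⟦ τ-BV→IA x̄ φ ⟧ ∩ Image (δ̄ x̄))

    τ-IA→BV      : ∀ x̄ → SynIA.Formula (x̄ ′ᶜ) → SynBV.Formula x̄
    τ-IA→BV-spec : ∀ x̄ φ′ →
      SemBV.⟦ τ-IA→BV x̄ φ′ ⟧ ≐ δ̄ x̄ ⊢ (SemIA.⟦ φ′ ⟧ ∩ Image (δ̄ x̄))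

  ρ-at : ∀ x̄ {x} → x ∈ SynBV.vars x̄ → SynIA.Formula (x̄ ′ᶜ)
  ρ-at x̄ {x} i = SynIA.rename ((_ , ∈-map⁺ _′ i) ∷ []) (ρ x)

-- Π^BV and Π^IA are represented by Π itself, indexed by the theory.
module Predicates (𝓣 : Transformers) {Π : Set} (ȳ : Π → SynBV.Ctx) where
  open Transformers 𝓣

  params : (a : Theory) → Π → Syntax.Ctx (sig a)
  params BV p = ȳ p
  params IA p = ȳ p ′ᶜ

  module H (a : Theory) = Horn (sig a) (model a) (params a)

  module HBV = Horn Σ-BV M-BV (params BV)
  module HIA = Horn Σ-IA (model IA) (params IA)

  FormulaOver : Theory → Π → Set
  FormulaOver a p = Syntax.Formula (sig a) (params a p)

  Tuple : Theory → Π → Set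
  Tuple a p = Semantics.Env (sig a) (model a) (params a p)

  τ : ∀ a p → FormulaOver a p → FormulaOver (other a) p
  τ BV p = τ-BV→IA (ȳ p)
  τ IA p = τ-IA→BV (ȳ p)

  R : ∀ a p → FormulaOver a p
  R BV p = SynBV.⊤′
  R IA p = SynIA.⋀ (mapWith∈ (SynBV.vars (ȳ p)) (ρ-at (ȳ p)))

  argVars : ∀ {x̄} → HBV.Atom x̄ → List SynBV.Var
  argVars (_ HBV.⟪ x̄ₚ ⟫) = All.reduce (λ {y} (n , _) → proj₁ y , n) x̄ₚ

  encodeAtom : ∀ {x̄} → HBV.Atom x̄ → HIA.Atom (x̄ ′ᶜ)
  encodeAtom (p HBV.⟪ x̄ₚ ⟫) =
    p HIA.⟪ All.map⁺ (All.map (λ (_ , i) → _ , ∈-map⁺ _′ i) x̄ₚ) ⟫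

  encodeClause : HBV.Clause → HIA.Clause
  encodeClause c = record
    { vars       = x̄ ′ᶜ
    ; constraint = τ-BV→IA x̄ (HBV.constraint c) SynIA.∧′
                   SynIA.⋀ (mapWith∈ (filter free? (SynBV.vars x̄))
                                     (ρ-at x̄ ∘ proj₁ ∘ ∈-filter⁻ free?))
    ; body       = map encodeAtom (HBV.body c)
    ; head       = Maybe.map encodeAtom (HBV.head c)
    }
    where
    open DecMembership _≟ᵛ_ using (_∈?_)
    x̄ = HBV.vars c
    free? = λ x → ¬? (x ∈? concatMap argVars (HBV.body c))

  -- The variables in argument position i of p have the same domain
  -- transformer as the i-th variable of ȳ p.
  Coherent : Pred HBV.Clause 0ℓ → Set
  Coherent Φ = ∀ c → Φ c →
    All CoherentAtom (HBV.body c) × (∀ A → HBV.head c ≡ just A → CoherentAtom A)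
    where
    CoherentAtom : ∀ {x̄} → HBV.Atom x̄ → Set
    CoherentAtom (p HBV.⟪ x̄ₚ ⟫) = ∀ {s m} (i : (s , m) ∈ SynBV.vars (ȳ p)) →
      ∀ v → δ (s , proj₁ (All.lookup x̄ₚ i)) v ≡ δ (s , m) v

  -- (Φ_BV, Φ_IA, I); `interface a p` states (p^b , p^a) ∈ I with b = other a.
  record Triple : Set₁ where
    field
      fragment  : (a : Theory) → Pred (H.Clause a) 0ℓ
      interface : (a : Theory) → Pred Π 0ℓ

  encoding : (Φ Δ-BV : Pred HBV.Clause 0ℓ) → Triple
  encoding Φ Δ-BV = record
    { fragment  = fragment
    ; interface = λ a p → H.HeadOf (other a) (fragment (other a)) p
                        × H.BodyOf a (fragment a) p
    }
    where
    fragment : (a : Theory) → Pred (H.Clause a) 0ℓ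
    fragment BV = Δ-BV
    fragment IA = λ c′ → ∃[ c ] (Φ ∖ Δ-BV) c × encodeClause c ≡ c′

  module _ (E : Triple) where
    open Triple E

    mutual
      ⟦_⟧^ : ℕ → (a : Theory) (p : Π) → Pred (Tuple a p) 0ℓ
      ⟦ n ⟧^ a p = Local n a p ∪ External n a p

      Local : ℕ → (a : Theory) (p : Π) → Pred (Tuple a p) 0ℓ
      Local zero    a = H.Consequences a (fragment a) (λ _ → ∅)
      Local (suc n) a = H.Consequences a (fragment a) (⟦ n ⟧^ a)

      External : ℕ → (a : Theory) (p : Π) → Pred (Tuple a p) 0ℓ
      External zero    a  p v = ⊥
      External (suc n) IA p v =
        interface IA p × (∃[ u ] ⟦ n ⟧^ BV p u × δ̄ (ȳ p) u ≡ v)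
      External (suc n) BV p v = interface BV p × ⟦ n ⟧^ IA p (δ̄ (ȳ p) v)

    TripleSemantics : (a : Theory) (p : Π) → Pred (Tuple a p) 0ℓ
    TripleSemantics a p v = ∃[ n ] ⟦ n ⟧^ a p v

    TripleSatisfiable : Set
    TripleSatisfiable = ∀ a → H.QueriesHold a (fragment a) (TripleSemantics a)

    QueryFree : Set
    QueryFree = ∀ a c → fragment a c → ¬ H.IsQuery a c

  χ : (q : Π) → FormulaOver BV q → HBV.Clause
  χ q φ = record
    { vars       = ȳ q
    ; constraint = φ
    ; body       = [ HBV.generic q ]
    ; head       = nothing
    }

  addQuery : Triple → HBV.Clause → Triple
  addQuery E c = record { fragment = fragment′ ; interface = interface }
    where
    open Triple E
    fragment′ : (a : Theory) → Pred (H.Clause a) 0ℓ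
    fragment′ BV = fragment BV ∪ ｛ c ｝
    fragment′ IA = fragment IA

data Result : Set where
  SAT UNSAT : Result

module Procedure (𝓣 : Transformers) {Π : Set} (_≟_ : DecidableEquality Π)
                 (ȳ : Π → SynBV.Ctx) where
  open Predicates 𝓣 ȳ

  Labelled : Set
  Labelled = Σ[ a ∈ Theory ] Σ[ p ∈ Π ] FormulaOver a p

  lemmas : ∀ a s → List Labelled → List (FormulaOver a s)
  lemmas a  s []                 = []
  lemmas BV s ((IA , _ , _) ∷ L) = lemmas BV s L
  lemmas IA s ((BV , _ , _) ∷ L) = lemmas IA s L
  lemmas BV s ((BV , r , ψ) ∷ L) with r ≟ s
  ... | yes refl = ψ ∷ lemmas BV s L
  ... | no  _    = lemmas BV s L
  lemmas IA s ((IA , r , ψ) ∷ L) with r ≟ s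
  ... | yes refl = ψ ∷ lemmas IA s L
  ... | no  _    = lemmas IA s L

  -- Q, U and O are finite sets, represented by lists.
  record State : Set where
    constructor ⟨_,_,_⟩
    field
      Q U O : List Labelled

  infix 4 _≗ˡ_
  _≗ˡ_ : List Labelled → Pred Labelled 0ℓ → Set
  Q ≗ˡ P = (_∈ Q) ≐ P

  Query : ∀ a p → FormulaOver a p → Pred (H.Clause a) 0ℓ
  Query a p φ = ｛ record
    { vars       = params a p
    ; constraint = φ ∧′ R a p
    ; body       = [ H.generic a p ]
    ; head       = nothing
    } ｝
    where open Syntax (sig a)

  module _ (E : Triple) where
    open Triple E

    extend : ∀ a → (∀ s → FormulaOver a s) → Pred (H.Clause a) 0ℓ
    extend a θ = fragment a ∪ λ c → ∃[ s ] interface a s × summary s ≡ c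
      where
      open Syntax (sig a)
      summary : Π → H.Clause a
      summary s = record
        { vars       = params a s
        ; constraint = θ s ∧′ R a s
        ; body       = []
        ; head       = just (H.generic a s)
        }

    Φᴼ Φᵁ : ∀ a → List Labelled → Pred (H.Clause a) 0ℓ
    Φᴼ a O = extend a (λ s → Syntax.⋀ (sig a) (lemmas a s O))
    Φᵁ a U = extend a (λ s → Syntax.⋁ (sig a) (lemmas a s U))

    module _ (q : Π) (φq : FormulaOver BV q) where

      goal : Labelled
      goal = BV , q , φq

      initial : State
      initial = ⟨ [ goal ] , [] , [] ⟩

      infix 4 _⟶_
      data _⟶_ : State → State → Set where

        negAnswer : ∀ {Q Q′ U O a p φ} (J : H.SymbolicInterpretation a) →
          ((_∈ Q) ∖ ｛ goal ｝) (a , p , φ) →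
          H._⊨_ a J (Φᴼ a O ∪ Query a p φ) →
          Q′ ≗ˡ (_∈ Q) ∖ ｛ a , p , φ ｝ →
          ⟨ Q , U , O ⟩ ⟶ ⟨ Q′ , U , (other a , p , τ a p (J p)) ∷ O ⟩

        posAnswer : ∀ {Q Q′ U O a p φ} →
          ((_∈ Q) ∖ ｛ goal ｝) (a , p , φ) →
          (π : H.Refutation a (Φᵁ a U ∪ Query a p φ) p φ) →
          Q′ ≗ˡ (_∈ Q) ∖ ｛ a , p , φ ｝ →
          ⟨ Q , U , O ⟩ ⟶ ⟨ Q′ , (other a , p , τ a p (H.Refutation.ψ {a} π)) ∷ U , O ⟩

        query : ∀ {Q U O a p φ r ψ} (J : H.SymbolicInterpretation a) →
          (a , p , φ) ∈ Q →
          H._⊨_ a J (Φᵁ a U ∪ Query a p φ) →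
          (π : H.Refutation a (Φᴼ a O ∪ Query a p φ) p φ) →
          H.Leaf a r ψ (H.Refutation.child a π) →
          interface a r →
          ⟨ Q , U , O ⟩ ⟶ ⟨ (other a , r , τ a r ψ) ∷ Q , U , O ⟩

      data Answers : State → Result → Set where

        sat : ∀ {Q U O} (J : H.SymbolicInterpretation BV) →
          Q ≗ˡ ｛ goal ｝ →
          H._⊨_ BV J (Φᴼ BV O ∪ Query BV q φq) →
          Answers ⟨ Q , U , O ⟩ SAT

        unsat : ∀ {Q U O} →
          Q ≗ˡ ｛ goal ｝ →
          H.Refutation BV (Φᵁ BV U ∪ Query BV q φq) q φq →
          Answers ⟨ Q , U , O ⟩ UNSAT

      SolveReturns : Result → Set
      SolveReturns r = ∃[ st ] Star _⟶_ initial st × Answers st r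

{-# OPTIONS --safe #-}

-- Every lemma in O contains what its predicate receives from the other
-- theory, and every lemma in U, restricted to the image of the domain
-- transformers, is contained in the semantics of its predicate.  Hence a model
-- of Φᴼ is an inductive invariant of the stages of the encoding, and the
-- semantics of the encoding is closed under the clauses of Φᵁ; the
-- specifications of the theory transformers carry these facts over to the
-- lemma added by an answer.
module Submission where

open import Defs
open import Data.Empty using (⊥-elim)
open import Data.Integer.Base using (ℤ)
open import Data.List.Base using (List; []; _∷_; map)
open import Data.List.Membership.Propositional using (_∈_; mapWith∈)
open import Data.List.Membership.Propositional.Properties using (∈-map⁺)
open import Data.List.Relation.Unary.All as All using (All; []; _∷_)
import Data.List.Relation.Unary.All.Properties as All
open import Data.List.Relation.Unary.Any using (here; there)
open import Data.Maybe.Base using (just)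
open import Data.Nat.Base using (zero; suc; _≤_; _≤′_; ≤′-refl; ≤′-step; _⊔_)
open import Data.Nat.Properties using (≤⇒≤′; m≤m⊔n; m≤n⊔m)
open import Data.Product.Base using (∃-syntax; _×_; _,_; proj₁; proj₂)
open import Data.Sum.Base using (_⊎_; inj₁; inj₂)
open import Data.Unit.Base using (tt)
open import Function.Base using (_∘_; id)
open import Level using (0ℓ)
open import Relation.Binary.Construct.Closure.ReflexiveTransitive using (Star; ε; _◅_)
open import Relation.Binary.Definitions using (DecidableEquality)
open import Relation.Binary.PropositionalEquality using (_≡_; refl; sym; cong; cong₂; subst)
open import Relation.Nullary.Decidable using (yes; no)
open import Relation.Nullary.Negation using (¬_)
open import Relation.Unary using (Pred; _⊆_; _∪_)

-- Substitution and finite connectives in formulas.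

map-tabulate-lookup : {A : Set} {P Q : Pred A 0ℓ} {xs : List A} (e : All P xs)
  (f : ∀ {x} → x ∈ xs → Q x) (g : ∀ {x} → Q x → P x) →
  (∀ {x} (i : x ∈ xs) → g (f i) ≡ All.lookup e i) →
  All.map g (All.tabulate f) ≡ e
map-tabulate-lookup []      f g v≡ = refl
map-tabulate-lookup (p ∷ e) f g v≡ =
  cong₂ _∷_ (v≡ (here refl)) (map-tabulate-lookup e (f ∘ there) g (v≡ ∘ there))

module FormulaSemantics (Sg : Signature) (M : Structure Sg) where
  open Syntax Sg
  open Semantics Sg M

  mutual
    evalᵗ-rename : ∀ ȳ x̄ {s} (e : Env x̄) (r : Renaming ȳ x̄) (t : Term ȳ s) →
      evalᵗ {x̄} e (renameᵗ r t) ≡ evalᵗ (evalᴿ ȳ x̄ e r) t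
    evalᵗ-rename ȳ x̄ e r (var (_ , i)) = sym (All.lookup-map r i)
    evalᵗ-rename ȳ x̄ e r (fun f ts)    =
      cong (Structure.func M f) (evalᵗˢ-rename ȳ x̄ e r ts)

    evalᵗˢ-rename : ∀ ȳ x̄ {ss} (e : Env x̄) (r : Renaming ȳ x̄) (ts : Terms ȳ ss) →
      evalᵗˢ {x̄} e (renameᵗˢ r ts) ≡ evalᵗˢ (evalᴿ ȳ x̄ e r) ts
    evalᵗˢ-rename ȳ x̄ e r []       = refl
    evalᵗˢ-rename ȳ x̄ e r (t ∷ ts) =
      cong₂ _∷_ (evalᵗ-rename ȳ x̄ e r t) (evalᵗˢ-rename ȳ x̄ e r ts)

  module _ ȳ x̄ (e : Env x̄) (r : Renaming ȳ x̄) where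

    -- An equality of types instead of two implications: negation and implication are contravariant,
    -- so one induction then covers both directions.
    ⟦rename⟧ : (φ : Formula ȳ) → ⟦ rename {x̄ = x̄} r φ ⟧ e ≡ ⟦ φ ⟧ (evalᴿ ȳ x̄ e r)
    ⟦rename⟧ ⊤′         = refl
    ⟦rename⟧ ⊥′         = refl
    ⟦rename⟧ (rel p ts) = cong (Structure.rel M p) (evalᵗˢ-rename ȳ x̄ e r ts)
    ⟦rename⟧ (¬′ φ)     = cong ¬_ (⟦rename⟧ φ)
    ⟦rename⟧ (φ ∧′ ψ)   = cong₂ _×_ (⟦rename⟧ φ) (⟦rename⟧ ψ)
    ⟦rename⟧ (φ ∨′ ψ)   = cong₂ _⊎_ (⟦rename⟧ φ) (⟦rename⟧ ψ)
    ⟦rename⟧ (φ ⇒′ ψ)   = cong₂ (λ A B → A → B) (⟦rename⟧ φ) (⟦rename⟧ ψ)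

    rename⁺ : (φ : Formula ȳ) → ⟦ φ ⟧ (evalᴿ ȳ x̄ e r) → ⟦ rename {x̄ = x̄} r φ ⟧ e
    rename⁺ φ = subst id (sym (⟦rename⟧ φ))

    rename⁻ : (φ : Formula ȳ) → ⟦ rename {x̄ = x̄} r φ ⟧ e → ⟦ φ ⟧ (evalᴿ ȳ x̄ e r)
    rename⁻ φ = subst id (⟦rename⟧ φ)

  evalᴿ-id : ∀ x̄ (e : Env x̄) → evalᴿ x̄ x̄ e (idᴿ x̄) ≡ e
  evalᴿ-id x̄ e = map-tabulate-lookup e _ _ (λ _ → refl)

  rename-id⁺ : ∀ x̄ (e : Env x̄) (φ : Formula x̄) → ⟦ φ ⟧ e → ⟦ rename (idᴿ x̄) φ ⟧ e
  rename-id⁺ x̄ e φ = rename⁺ x̄ x̄ e (idᴿ x̄) φ ∘ subst ⟦ φ ⟧ (sym (evalᴿ-id x̄ e))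

  rename-id⁻ : ∀ x̄ (e : Env x̄) (φ : Formula x̄) → ⟦ rename (idᴿ x̄) φ ⟧ e → ⟦ φ ⟧ e
  rename-id⁻ x̄ e φ = subst ⟦ φ ⟧ (evalᴿ-id x̄ e) ∘ rename⁻ x̄ x̄ e (idᴿ x̄) φ

  ⋀⁺ : ∀ x̄ {e : Env x̄} {φs : List (Formula x̄)} → All (λ φ → ⟦ φ ⟧ e) φs → ⟦ ⋀ φs ⟧ e
  ⋀⁺ x̄ []       = tt
  ⋀⁺ x̄ (h ∷ hs) = h , ⋀⁺ x̄ hs

  ⋁⁻ : ∀ x̄ {e : Env x̄} {X : Set} {φs : List (Formula x̄)} → All (λ φ → ⟦ φ ⟧ e → X) φs → ⟦ ⋁ φs ⟧ e → X
  ⋁⁻ x̄ (h ∷ hs) (inj₁ x) = h x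
  ⋁⁻ x̄ (h ∷ hs) (inj₂ y) = ⋁⁻ x̄ hs y

  ⋀-mapWith∈⁺ : ∀ x̄ {e : Env x̄} {A : Set} (xs : List A) {f : ∀ {x} → x ∈ xs → Formula x̄} →
    (∀ {x} (i : x ∈ xs) → ⟦ f i ⟧ e) → ⟦ ⋀ (mapWith∈ xs f) ⟧ e
  ⋀-mapWith∈⁺ x̄ []       h = tt
  ⋀-mapWith∈⁺ x̄ (x ∷ xs) h = h (here refl) , ⋀-mapWith∈⁺ x̄ xs (h ∘ there)

  ⋀-mapWith∈⁻ : ∀ x̄ {e : Env x̄} {A : Set} (xs : List A) {f : ∀ {x} → x ∈ xs → Formula x̄} →
    ⟦ ⋀ (mapWith∈ xs f) ⟧ e → ∀ {x} (i : x ∈ xs) → ⟦ f i ⟧ e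
  ⋀-mapWith∈⁻ x̄ (x ∷ xs) (h , _)  (here refl) = h
  ⋀-mapWith∈⁻ x̄ (x ∷ xs) (_ , hs) (there i)   = ⋀-mapWith∈⁻ x̄ xs hs i

-- Horn clauses and their least semantics.

module HornSemantics (Sg : Signature) (M : Structure Sg)
                     {Π : Set} (params : Π → Syntax.Ctx Sg) where
  open Syntax Sg hiding (vars)
  open Semantics Sg M
  open FormulaSemantics Sg M
  open Horn Sg M params

  Body-mono : ∀ {𝓘 𝓙 : Interpretation} → (∀ p → 𝓘 p ⊆ 𝓙 p) → ∀ c → Body 𝓘 c ⊆ Body 𝓙 c
  Body-mono 𝓘⊆𝓙 c (h , hs) = h , All.map (𝓘⊆𝓙 _) hs

  -- Clauses without a head produce nothing, so inclusion is asked only of clauses with a head; this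
  -- lets a query be dropped.
  Consequences-mono : ∀ {Ψ Ψ′ : Pred Clause 0ℓ} {𝓘 𝓙 : Interpretation} →
    (∀ {c A} → head c ≡ just A → Ψ c → Ψ′ c) → (∀ p → 𝓘 p ⊆ 𝓙 p) →
    ∀ p → Consequences Ψ 𝓘 p ⊆ Consequences Ψ′ 𝓙 p
  Consequences-mono Ψ⊆Ψ′ 𝓘⊆𝓙 p (c , c∈Ψ , e , b , x̄ₚ , hd , v≡) =
    c , Ψ⊆Ψ′ hd c∈Ψ , e , Body-mono 𝓘⊆𝓙 c b , x̄ₚ , hd , v≡

  ClauseSemantics-least : ∀ {Ψ} {𝓘 : Interpretation} →
    (∀ p → Consequences Ψ 𝓘 p ⊆ 𝓘 p) → ∀ p → ClauseSemantics Ψ p ⊆ 𝓘 p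
  ClauseSemantics-least {Ψ} {𝓘} closed p (n , v∈S) = go n p v∈S
    where
    go : ∀ n p → S Ψ n p ⊆ 𝓘 p
    go zero    p = closed p ∘ Consequences-mono {𝓙 = 𝓘} (λ _ → id) (λ _ ()) p
    go (suc n) p = closed p ∘ Consequences-mono (λ _ → id) (go n) p

  -- Inclusion in `J` makes the instantiated body true, and validity of the instance then gives its
  -- head.
  ⊨-closed : ∀ {J Ψ} {𝓘 : Interpretation} → J ⊨ Ψ → (∀ p → 𝓘 p ⊆ ⟦ J p ⟧) →
    ∀ p → Consequences Ψ 𝓘 p ⊆ ⟦ J p ⟧
  ⊨-closed {J} {𝓘 = 𝓘} J⊨Ψ 𝓘⊆J p (c , c∈Ψ , e , (h , hs) , x̄ₚ , hd , refl)
    -- Abstracting `head c` in the type of the validity proof turns the conclusion of the instance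
    -- into the head formula.
    with head c | hd | J⊨Ψ c c∈Ψ e
  ... | _ | refl | valid =
    rename⁻ (params p) (vars c) e x̄ₚ (J p) (valid (h , ⋀⁺ (vars c) (All.map⁺ (All.map (λ {A} → atom A) hs))))
    where
    atom : (A : Atom (vars c)) → ⟦ A ⟧ᴬ 𝓘 e → ⟦ rename {x̄ = vars c} (Atom.args A) (J (Atom.symbol A)) ⟧ e
    atom (r ⟪ x̄ᵣ ⟫) = rename⁺ (params r) (vars c) e x̄ᵣ (J r) ∘ 𝓘⊆J r

  generic⁺ : ∀ (𝓘 : Interpretation) {p} {v : Env (params p)} →
    𝓘 p v → ⟦_⟧ᴬ {params p} (generic p) 𝓘 v
  generic⁺ 𝓘 {p} {v} = subst (𝓘 p) (sym (evalᴿ-id (params p) v))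

  generic⁻ : ∀ (𝓘 : Interpretation) {p} {v : Env (params p)} →
    ⟦_⟧ᴬ {params p} (generic p) 𝓘 v → 𝓘 p v
  generic⁻ 𝓘 {p} {v} = subst (𝓘 p) (evalᴿ-id (params p) v)

  derivation⊆ : ∀ {Ψ p ψ ts} → IsDerivation Ψ (node p ψ ts) → ⟦ ψ ⟧ ⊆ ClauseSemantics Ψ p
  derivation⊆ (leaf  (_ , ψ⊆) _) = ψ⊆
  derivation⊆ (inner (_ , ψ⊆) _) = ψ⊆

-- Images of the domain transformers and the formulas defining them.

module TransformerProperties (𝓣 : Transformers) where
  open Transformers 𝓣
  open FormulaSemantics Σ-IA (model IA)

  lookup-δ̄ : ∀ x̄ (u : SemBV.Env x̄) {x} (i : x ∈ SynBV.vars x̄) →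
    All.lookup (δ̄ x̄ u) (∈-map⁺ _′ i) ≡ δ x (All.lookup u i)
  lookup-δ̄ x̄ = go
    where
    go : ∀ {xs} (u : All (BitVec ∘ width ∘ proj₁) xs) {x} (i : x ∈ xs) →
      All.lookup {P = λ _ → ℤ} (All.map⁺ {f = _′} (All.map (λ {x} → δ x) u)) (∈-map⁺ _′ i) ≡ δ x (All.lookup u i)
    go (v ∷ u) (here refl) = refl
    go (v ∷ u) (there i)   = go u i

  δ̄-image⁺ : ∀ x̄ (w : SemIA.Env (x̄ ′ᶜ)) →
    (∀ {x} (i : x ∈ SynBV.vars x̄) → Image (δ x) (All.lookup w (∈-map⁺ _′ i))) →
    Image (δ̄ x̄) w
  -- The preimage collects the componentwise witnesses; `go` forgets distinctness so that induction
  -- on the list applies.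
  δ̄-image⁺ x̄ w im = All.tabulate (proj₁ ∘ im) , go w im
    where
    go : ∀ {xs} (w : All (λ _ → ℤ) (map _′ xs))
      (im : ∀ {x} (i : x ∈ xs) → Image (δ x) (All.lookup w (∈-map⁺ _′ i))) →
      All.map⁺ (All.map (λ {x} → δ x) (All.tabulate (proj₁ ∘ im))) ≡ w
    go {[]}     []      im = refl
    go {x ∷ xs} (z ∷ w) im = cong₂ _∷_ (proj₂ (im (here refl))) (go w (im ∘ there))

  -- For `x̄ = ȳ p` this unfolds to `R IA p`; the next two lemmas identify it with the image of
  -- `δ̄`.
  ρ̄ : ∀ x̄ → SynIA.Formula (x̄ ′ᶜ)
  ρ̄ x̄ = SynIA.⋀ (mapWith∈ (SynBV.vars x̄) (ρ-at x̄))

  ρ̄⁺ : ∀ x̄ → Image (δ̄ x̄) ⊆ SemIA.⟦ ρ̄ x̄ ⟧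
  ρ̄⁺ x̄ (u , refl) = ⋀-mapWith∈⁺ (x̄ ′ᶜ) (SynBV.vars x̄) λ {x} i →
    rename⁺ _ (x̄ ′ᶜ) _ _ (ρ x) (proj₂ (ρ-spec x) (All.lookup u i , sym (lookup-δ̄ x̄ u i)))

  ρ̄⁻ : ∀ x̄ → SemIA.⟦ ρ̄ x̄ ⟧ ⊆ Image (δ̄ x̄)
  ρ̄⁻ x̄ {w} h = δ̄-image⁺ x̄ w λ {x} i →
    proj₁ (ρ-spec x) (rename⁻ _ (x̄ ′ᶜ) _ _ (ρ x) (⋀-mapWith∈⁻ (x̄ ′ᶜ) (SynBV.vars x̄) h i))

-- Stages of the encoding.

module TripleProperties (𝓣 : Transformers) {Π : Set} (ȳ : Π → SynBV.Ctx) where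
  open Transformers 𝓣
  open Predicates 𝓣 ȳ
  module HP (a : Theory) = HornSemantics (sig a) (model a) (params a)

  stage-mono : (E E′ : Triple) →
    (∀ {a} {c : H.Clause a} {A} → H.head {a} c ≡ just A → Triple.fragment E a c → Triple.fragment E′ a c) →
    (∀ {a} → Triple.interface E a ⊆ Triple.interface E′ a) →
    ∀ n a p → ⟦_⟧^ E n a p ⊆ ⟦_⟧^ E′ n a p
  stage-mono E E′ frag intf = go
    where
    go : ∀ n a p → ⟦_⟧^ E n a p ⊆ ⟦_⟧^ E′ n a p
    go zero    a  p (inj₁ l) = inj₁ (HP.Consequences-mono a frag (λ _ → id) p l)
    go (suc n) a  p (inj₁ l) = inj₁ (HP.Consequences-mono a frag (go n a) p l)
    go (suc n) IA p (inj₂ (i , u , x , v≡)) = inj₂ (intf i , u , go n BV p x , v≡)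
    go (suc n) BV p (inj₂ (i , x))          = inj₂ (intf i , go n IA p x)

  TripleSemantics-addQuery : ∀ E q φ a p →
    TripleSemantics E a p ⊆ TripleSemantics (addQuery E (χ q φ)) a p
  TripleSemantics-addQuery E q φ a p (n , x) =
    n , stage-mono E (addQuery E (χ q φ)) (λ { {BV} _ → inj₁ ; {IA} _ → id }) id n a p x

  TripleSemantics-dropQuery : ∀ E q φ a p →
    TripleSemantics (addQuery E (χ q φ)) a p ⊆ TripleSemantics E a p
  TripleSemantics-dropQuery E q φ a p (n , x) =
    n , stage-mono (addQuery E (χ q φ)) E rules id n a p x
    where
    rules : ∀ {a} {c : H.Clause a} {A} → H.head {a} c ≡ just A →
      Triple.fragment (addQuery E (χ q φ)) a c → Triple.fragment E a c
    rules {BV} _  (inj₁ c∈E)  = c∈E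
    -- The added query has head `nothing`, contradicting the head equation.
    rules {BV} () (inj₂ refl)
    rules {IA} _  c∈E         = c∈E

  module _ (E : Triple) where
    open Triple E

    stage-suc : ∀ n a p → ⟦_⟧^ E n a p ⊆ ⟦_⟧^ E (suc n) a p
    stage-suc zero    a  p (inj₁ l) = inj₁ (HP.Consequences-mono a {𝓙 = ⟦_⟧^ E zero a} (λ _ → id) (λ _ ()) p l)
    stage-suc (suc n) a  p (inj₁ l) = inj₁ (HP.Consequences-mono a (λ _ → id) (stage-suc n a) p l)
    stage-suc (suc n) IA p (inj₂ (i , u , x , v≡)) = inj₂ (i , u , stage-suc n BV p x , v≡)
    stage-suc (suc n) BV p (inj₂ (i , x))          = inj₂ (i , stage-suc n IA p x)

    stage-≤ : ∀ {m n} → m ≤ n → ∀ a p → ⟦_⟧^ E m a p ⊆ ⟦_⟧^ E n a p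
    stage-≤ m≤n a p = go (≤⇒≤′ m≤n)
      where
      go : ∀ {m n} → m ≤′ n → ⟦_⟧^ E m a p ⊆ ⟦_⟧^ E n a p
      go ≤′-refl       = id
      go (≤′-step m≤n) = stage-suc _ a p ∘ go m≤n

    -- A body has finitely many atoms and the stages increase, so the maximum of their stages serves
    -- all of them.
    common-stage : ∀ a x̄ e {As : List (H.Atom a x̄)} →
      All (λ A → H.⟦_⟧ᴬ a A (TripleSemantics E a) e) As →
      ∃[ n ] All (λ A → H.⟦_⟧ᴬ a A (⟦_⟧^ E n a) e) As
    common-stage a x̄ e []                    = zero , []
    common-stage a x̄ e {A ∷ As} ((m , h) ∷ hs) with common-stage a x̄ e hs
    ... | n , hs′ = m ⊔ n , stage-≤ (m≤m⊔n m n) a (H.Atom.symbol {a} A) h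
                          ∷ All.map (λ {B} → stage-≤ (m≤n⊔m m n) a (H.Atom.symbol {a} B)) hs′

    -- With the whole body at one stage `n`, the head is local at stage `suc n`.
    TripleSemantics-closed : ∀ a p →
      H.Consequences a (fragment a) (TripleSemantics E a) p ⊆ TripleSemantics E a p
    TripleSemantics-closed a p (c , c∈E , e , (h , hs) , rest)
      with common-stage a (H.vars {a} c) e hs
    ... | n , hs′ = suc n , inj₁ (c , c∈E , e , (h , hs′) , rest)

    -- A tuple imported into integer arithmetic is an image under `δ̄`; this discharges the conjunct
    -- `R a p` of the summary clauses.
    External⇒R : ∀ n a p → External E n a p ⊆ Semantics.⟦_⟧ (sig a) (model a) (R a p)
    External⇒R (suc n) BV p _                = tt
    External⇒R (suc n) IA p (_ , u , _ , v≡) = TransformerProperties.ρ̄⁺ 𝓣 (ȳ p) (u , v≡)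

-- Soundness of the procedure.

module Soundness (𝓣 : Transformers) {Π : Set} (_≟_ : DecidableEquality Π)
                 (ȳ : Π → SynBV.Ctx) (E : Predicates.Triple 𝓣 ȳ) where
  open Transformers 𝓣
  open Predicates 𝓣 ȳ
  open Procedure 𝓣 _≟_ ȳ
  open TripleProperties 𝓣 ȳ
  open Triple E

  module F (a : Theory) = FormulaSemantics (sig a) (model a)

  Sat : ∀ a p → FormulaOver a p → Pred (Tuple a p) 0ℓ
  Sat a p = Semantics.⟦_⟧ (sig a) (model a)

  lemmas⁺ : ∀ {P : ∀ a p → FormulaOver a p → Set} a s {L} →
    All (λ (b , p , ψ) → P b p ψ) L → All (P a s) (lemmas a s L)
  lemmas⁺ a  s []                          = []
  lemmas⁺ BV s {(IA , _ , _) ∷ L} (h ∷ hs) = lemmas⁺ BV s hs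
  lemmas⁺ IA s {(BV , _ , _) ∷ L} (h ∷ hs) = lemmas⁺ IA s hs
  lemmas⁺ BV s {(BV , r , _) ∷ L} (h ∷ hs) with r ≟ s
  ... | yes refl = h ∷ lemmas⁺ BV s hs
  ... | no  _    = lemmas⁺ BV s hs
  lemmas⁺ IA s {(IA , r , _) ∷ L} (h ∷ hs) with r ≟ s
  ... | yes refl = h ∷ lemmas⁺ IA s hs
  ... | no  _    = lemmas⁺ IA s hs

  -- `Over` speaks of imported tuples only, since a translated lemma need not cover locally derived
  -- ones. `Under` is relative to `R`, since the theory transformers are specified only on the image
  -- of `δ̄`, and to `interface`, without which no tuple is passed on.
  Over Under : ∀ a p → FormulaOver a p → Set
  Over  a p ψ = ∀ n {v} → External E n a p v → Sat a p ψ v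
  Under a p ψ = interface a p → ∀ {v} →
    Sat a p ψ v → Sat a p (R a p) v → TripleSemantics E a p v

  OverApproximating UnderApproximating : List Labelled → Set
  OverApproximating  = All (λ (a , p , ψ) → Over a p ψ)
  UnderApproximating = All (λ (a , p , ψ) → Under a p ψ)

  External-interface : ∀ n a p → External E n a p ⊆ λ _ → interface a p
  External-interface (suc n) BV p = proj₁
  External-interface (suc n) IA p = proj₁

  -- Induction on stages: locally derived tuples are covered by the clauses of the fragment,
  -- imported ones by the summary clauses.
  ⊨Φᴼ⇒invariant : ∀ {a O} {J : H.SymbolicInterpretation a} →
    OverApproximating O → H._⊨_ a J (Φᴼ E a O) →
    ∀ p → TripleSemantics E a p ⊆ Sat a p (J p)
  ⊨Φᴼ⇒invariant {a} {O} {J} over J⊨ p (n , x) = go n p x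
    where
    external : ∀ n p → External E n a p ⊆ Sat a p (J p)
    external n p {v} x = F.rename-id⁻ a (params a p) v (J p)
      -- The summary clause of `p` at `v`: the lemmas in `O` hold of the imported `v`, and the last
      -- `tt` is its empty body.
      (J⊨ _ (inj₂ (p , External-interface n a p x , refl)) v
        ((F.⋀⁺ a (params a p) (All.map (λ h → h n x) (lemmas⁺ {P = Over} a p over)) , External⇒R E n a p x) , tt))

    go : ∀ n p → ⟦_⟧^ E n a p ⊆ Sat a p (J p)
    go n       p (inj₂ x) = external n p x
    go zero    p (inj₁ l) = HP.⊨-closed a {J} (λ c → J⊨ c ∘ inj₁) (λ _ ()) p l
    go (suc n) p (inj₁ l) = HP.⊨-closed a {J} (λ c → J⊨ c ∘ inj₁) (go n) p l

  -- The semantics of the encoding is closed under a summary clause because each disjunct is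
  -- under-approximating, and under the query because it has no head.
  ΦᵁSemantics⊆ : ∀ {a U r φ} → UnderApproximating U →
    ∀ p → H.ClauseSemantics a (Φᵁ E a U ∪ Query a r φ) p ⊆ TripleSemantics E a p
  ΦᵁSemantics⊆ {a} {U} {r} {φ} under = HP.ClauseSemantics-least a closed
    where
    closed : ∀ p → H.Consequences a (Φᵁ E a U ∪ Query a r φ) (TripleSemantics E a) p
                   ⊆ TripleSemantics E a p
    closed p (c , inj₁ (inj₁ c∈E) , produces) = TripleSemantics-closed E a p (c , c∈E , produces)
    closed p (_ , inj₁ (inj₂ (_ , i , refl)) , v , ((θ , ρ) , _) , _ , refl , refl) =
      HP.generic⁺ a (TripleSemantics E a) (F.⋁⁻ a (params a p) (All.map (λ h x → h i x ρ) (lemmas⁺ {P = Under} a p under)) θ)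
    closed p (_ , inj₂ refl , _ , _ , _ , () , _)

  -- A tuple imported at stage `suc n` comes from stage `n` of the other theory, where `ψ` holds;
  -- the specification of the transformer carries this across.
  Over-τ : ∀ a p ψ → TripleSemantics E a p ⊆ Sat a p ψ → Over (other a) p (τ a p ψ)
  Over-τ BV p ψ sem⊆ψ (suc n) (_ , u , x , refl) =
    proj₁ (proj₁ (τ-BV→IA-spec (ȳ p) ψ) (sem⊆ψ (n , x)))
  Over-τ IA p ψ sem⊆ψ (suc n) {v} (_ , x) =
    proj₂ (τ-IA→BV-spec (ȳ p) ψ) (sem⊆ψ (n , x) , v , refl)

  Under-τ : ∀ a p ψ → Sat a p ψ ⊆ TripleSemantics E a p → Under (other a) p (τ a p ψ)
  -- The domain restriction supplies the bit-vector preimage `u`; a tuple at stage `n` is imported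
  -- at `suc n`.
  Under-τ BV p ψ ψ⊆sem i x ρ with TransformerProperties.ρ̄⁻ 𝓣 (ȳ p) ρ
  ... | u , refl with ψ⊆sem (proj₂ (τ-BV→IA-spec (ȳ p) ψ) (x , u , refl))
  ...   | n , y = suc n , inj₂ (i , u , y , refl)
  Under-τ IA p ψ ψ⊆sem i x _ with ψ⊆sem (proj₁ (proj₁ (τ-IA→BV-spec (ȳ p) ψ) x))
  ... | n , y = suc n , inj₂ (i , y)

  child⊆ : ∀ {a U p φ} → UnderApproximating U →
    (π : H.Refutation a (Φᵁ E a U ∪ Query a p φ) p φ) →
    Sat a p (H.Refutation.ψ {a} π) ⊆ TripleSemantics E a p
  child⊆ {a} {p = p} under π =
    ΦᵁSemantics⊆ under p ∘ HP.derivation⊆ a (H.Refutation.derivation {a} π)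

  -- Invariants of runs and the two answers.

  module _ (q : Π) (φq : FormulaOver BV q) where

    -- Only `negAnswer` extends `O`, and its `J` contains the semantics, so `Over-τ` covers the new
    -- lemma.
    reachable-over : ∀ {st st′} → Star (_⟶_ E q φq) st st′ →
      OverApproximating (State.O st) → OverApproximating (State.O st′)
    reachable-over ε over = over
    reachable-over (negAnswer {a = a} {p} J _ J⊨ _ ◅ run) over =
      reachable-over run (Over-τ a p (J p) (⊨Φᴼ⇒invariant over (λ c → J⊨ c ∘ inj₁) p) ∷ over)
    reachable-over (posAnswer _ _ _ ◅ run)     over = reachable-over run over
    reachable-over (query _ _ _ _ _ _ ◅ run)   over = reachable-over run over

    -- Only `posAnswer` extends `U`, by the translation of a root child whose `ψ` lies inside the
    -- semantics.
    reachable-under : ∀ {st st′} → Star (_⟶_ E q φq) st st′ →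
      UnderApproximating (State.U st) → UnderApproximating (State.U st′)
    reachable-under ε under = under
    reachable-under (negAnswer _ _ _ _ ◅ run)   under = reachable-under run under
    reachable-under (posAnswer {a = a} {p} _ π _ ◅ run) under =
      reachable-under run (Under-τ a p _ (child⊆ under π) ∷ under)
    reachable-under (query _ _ _ _ _ _ ◅ run)   under = reachable-under run under

    SAT-sound : QueryFree E → SolveReturns E q φq SAT → TripleSatisfiable (addQuery E (χ q φq))
    SAT-sound free (_ , run , sat J _ J⊨) IA c c∈E isQ = ⊥-elim (free IA c c∈E isQ)
    SAT-sound free (_ , run , sat J _ J⊨) BV c (inj₁ c∈E) isQ = ⊥-elim (free BV c c∈E isQ)
    SAT-sound free (_ , run , sat J _ J⊨) BV _ (inj₂ refl) _ e (φ , x ∷ []) =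
      -- The invariant puts `e` in `J q`, so the query clause, valid under `J`, yields falsity; the
      -- first `tt` is `R BV q`.
      J⊨ _ (inj₂ refl) e ((φ , tt) , F.rename-id⁺ BV (ȳ q) e (J q) Jq , tt)
      where
      Jq : Sat BV q (J q) e
      Jq = ⊨Φᴼ⇒invariant (reachable-over run []) (λ c → J⊨ c ∘ inj₁) q
        (TripleSemantics-dropQuery E q φq BV q (HP.generic⁻ BV (TripleSemantics (addQuery E (χ q φq)) BV) x))

    -- The field `ψ∧φ-sat` gives a tuple that satisfies `φq` and lies in the semantics of `q`, which
    -- makes the body of the added query true.
    UNSAT-sound : SolveReturns E q φq UNSAT → ¬ TripleSatisfiable (addQuery E (χ q φq))
    UNSAT-sound (_ , run , unsat _ π) satisfiable with H.Refutation.ψ∧φ-sat π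
    ... | e , ψ , φ = satisfiable BV (χ q φq) (inj₂ refl) refl e
      (φ , HP.generic⁺ BV (TripleSemantics (addQuery E (χ q φq)) BV)
             (TripleSemantics-addQuery E q φq BV q (child⊆ (reachable-under run []) π ψ)) ∷ [])

theorem4 :
    (𝓣 : Transformers)
    {Π : Set} (_≟_ : DecidableEquality Π) (ȳ : Π → SynBV.Ctx) →
    let open Predicates 𝓣 ȳ
        open Procedure 𝓣 _≟_ ȳ in
    (Φ : Pred HBV.Clause 0ℓ) →
    (∀ c → Φ c → HBV.AllVarsAppear c) →
    Coherent Φ →
    (Δ-BV : Pred HBV.Clause 0ℓ) → Δ-BV ⊆ Φ →
    let E = encoding Φ Δ-BV in
    QueryFree E →
    (q : Π) (φq : FormulaOver BV q) →
    HBV.AllVarsAppear (χ q φq) →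
    (SolveReturns E q φq SAT → TripleSatisfiable (addQuery E (χ q φq))) ×
    (SolveReturns E q φq UNSAT → ¬ TripleSatisfiable (addQuery E (χ q φq)))
theorem4 𝓣 _≟_ ȳ Φ _ _ Δ-BV _ queryFree q φq _ =
  SAT-sound q φq queryFree , UNSAT-sound q φq
  where
  open Predicates 𝓣 ȳ using (encoding)
  open Soundness 𝓣 _≟_ ȳ (encoding Φ Δ-BV)
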